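{- Let $G$ be a cubic graph admitting a 3-malleable vertex. Then $G$ is 2FH and all vertices of $G$ are 3-malleable.
   Context: Graphs are finite and connected, may have multiple (parallel) edges, and have no loops. The degree of a vertex is the number of edges incident to it; a cubic graph is a 3-regular graph. A $2$-factor of $G$ is a $2$-regular spanning subgraph (not necessarily connected; two parallel edges count as a $2$-regular component on two vertices), and a Hamiltonian cycle is a connected $2$-factor. A perfect matching is the edge set of a $1$-regular spanning subgraph. A Hamiltonian cycle $H$ extends a perfect matching $M$ if $M\subseteq E(H)$. A graph is 2FH (2-factor Hamiltonian) if it has a Hamiltonian cycle and each of its $2$-factors is a Hamiltonian cycle. For a vertex $v$, $\partial v$ denotes the set of edges incident to $v$. If $G$ admits a perfect matching and $v$ is a vertex of degree $t\ge 2$, then $v$ is $t$-malleable if for every perfect matching $M$ of $G$ there exist Hamiltonian cycles $H_1,\dots,H_{t-1}$ of $G$, all extending $M$, such that $\partial v - M\subset \bigcup_{i=1}^{t-1}E(H_i)$. (In particular, a graph with a $t$-malleable vertex admits a perfect matching.) -}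

module Defs where

open import Data.Fin using (Fin; _≟_)
open import Data.Fin.Subset using (Subset; ⊤; _∈_; _⊆_; _∩_; _─_; ⋃; ∣_∣)
open import Data.List using (tabulate)
open import Data.Nat using (ℕ; _≤_; _∸_)
open import Data.Product using (Σ; ∃; ∃-syntax; _×_)
open import Data.Sum using (_⊎_)
import Data.Vec as Vec
open import Relation.Binary.Construct.Closure.ReflexiveTransitive using (Star)
open import Relation.Binary.PropositionalEquality using (_≡_; _≢_)
open import Relation.Nullary using (Dec; does)
open import Relation.Nullary.Decidable using (_⊎-dec_)

-- Edges are named by Fin #E, so several edges may share the same ends.
-- The order of the two ends of an edge carries no meaning: every notion
-- below is symmetric in end₁ and end₂.
record LooplessMultigraph : Set where
  field
    #V #E     : ℕ
    end₁ end₂ : Fin #E → Fin #V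
    loopless  : ∀ e → end₁ e ≢ end₂ e

  Vertex : Set
  Vertex = Fin #V

  Edge : Set
  Edge = Fin #E

  -- A set of edges also stands for the spanning subgraph with these edges.
  EdgeSet : Set
  EdgeSet = Subset #E

  Incident : Vertex → Edge → Set
  Incident v e = (end₁ e ≡ v) ⊎ (end₂ e ≡ v)

  incident? : ∀ v e → Dec (Incident v e)
  incident? v e = (end₁ e ≟ v) ⊎-dec (end₂ e ≟ v)

  ∂ : Vertex → EdgeSet
  ∂ v = Vec.tabulate λ e → does (incident? v e)

  degree : Vertex → ℕ
  degree v = ∣ ∂ v ∣

  degreeIn : EdgeSet → Vertex → ℕ
  degreeIn F v = ∣ ∂ v ∩ F ∣

  Joins : Edge → Vertex → Vertex → Set
  Joins e u w = (end₁ e ≡ u × end₂ e ≡ w) ⊎ (end₁ e ≡ w × end₂ e ≡ u)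

  Adjacent : EdgeSet → Vertex → Vertex → Set
  Adjacent F u w = ∃[ e ] (e ∈ F × Joins e u w)

  -- Connectedness of the spanning subgraph, so every vertex must be
  -- reached, including those that no edge of F meets.
  Connected : EdgeSet → Set
  Connected F = ∀ u w → Star (Adjacent F) u w

record Graph : Set where
  field
    multigraph : LooplessMultigraph

  open LooplessMultigraph multigraph public

  field
    connected : Connected ⊤

module _ (G : Graph) where
  open Graph G

  IsCubic : Set
  IsCubic = ∀ v → degree v ≡ 3

  IsTwoFactor : EdgeSet → Set
  IsTwoFactor F = ∀ v → degreeIn F v ≡ 2

  IsHamiltonianCycle : EdgeSet → Set
  IsHamiltonianCycle F = IsTwoFactor F × Connected F

  IsPerfectMatching : EdgeSet → Set
  IsPerfectMatching M = ∀ v → degreeIn M v ≡ 1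

  Is2FH : Set
  Is2FH = ∃ IsHamiltonianCycle × (∀ F → IsTwoFactor F → IsHamiltonianCycle F)

  -- The cycles H i need not be distinct.
  IsMalleable : ℕ → Vertex → Set
  IsMalleable t v =
    2 ≤ t × degree v ≡ t × ∃ IsPerfectMatching ×
    (∀ M → IsPerfectMatching M →
      Σ (Fin (t ∸ 1) → EdgeSet) λ H →
        (∀ i → IsHamiltonianCycle (H i) × M ⊆ H i) ×
        (∂ v ─ M) ⊆ ⋃ (tabulate H))

{-# OPTIONS --safe #-}
module Submission where

open import Defs
open import Data.Product using (∃; ∃-syntax; _×_; _,_; proj₁; proj₂)
open import Data.Bool using (true; false)
open import Data.Fin using (Fin; zero; suc; _≟_)
open import Data.Fin.Subset using (Subset; ⊤; _∈_; _∉_; _⊆_; _∩_; _─_; ⋃; ∣_∣)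
open import Data.Fin.Subset.Properties
open import Data.List using (tabulate)
open import Data.Nat using (ℕ; suc; _+_; s≤s; z≤n)
open import Data.Nat.Properties using (<-irrefl; +-suc; +-cancelʳ-≡)
open import Data.Sum using (inj₁; inj₂)
open import Data.Vec using ([]; _∷_; here; there)
open import Data.Vec.Properties using (lookup⇒[]=; lookup∘tabulate)
open import Function using (_∘_; id)
open import Relation.Binary.Construct.Closure.ReflexiveTransitive using (Star; ε; _◅_)
import Relation.Binary.Construct.Closure.ReflexiveTransitive as Star
open import Relation.Binary.PropositionalEquality
  using (_≡_; refl; sym; trans; cong; subst)
open import Relation.Nullary using (yes; no; contradiction)
open import Relation.Nullary.Decidable using (decidable-stable; dec-true)

-- Let F be a 2-factor with complementary perfect matching M, and let H ⊇ M be
-- a Hamiltonian cycle given by malleability at v. The complement N of H is a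
-- perfect matching contained in F. If f is the edge of H ─ M at v, malleability
-- for N gives a Hamiltonian cycle K ⊇ N through f. Now K ─ N and H ─ M are
-- perfect matchings of the cycle H sharing f, hence equal, so that K = F.
-- For an arbitrary vertex, the 2-factors H and M ∪ N (which is now Hamiltonian
-- too) both extend M, and they cover all edges.

private variable
  n k : ℕ
  p q : Subset n
  x y : Fin n

x∈p─q⇒x∉q : x ∈ p ─ q → x ∉ q
x∈p─q⇒x∉q {p = _ ∷ p} {q = _ ∷ q} (there x∈p─q) (there x∈q) =
  x∈p─q⇒x∉q {p = p} {q = q} x∈p─q x∈q

∣d∩[p─q]∣+∣d∩q∣≡∣d∩p∣ : ∀ (d p q : Subset n) → q ⊆ p →
  ∣ d ∩ (p ─ q) ∣ + ∣ d ∩ q ∣ ≡ ∣ d ∩ p ∣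
∣d∩[p─q]∣+∣d∩q∣≡∣d∩p∣ [] [] [] _ = refl
∣d∩[p─q]∣+∣d∩q∣≡∣d∩p∣ (s ∷ d) (t ∷ p) (u ∷ q) q⊆p
  with ∣d∩[p─q]∣+∣d∩q∣≡∣d∩p∣ d p q (drop-∷-⊆ q⊆p)
... | ih with s | t | u
... | false | _     | false = ih
... | false | _     | true  = ih
... | true  | false | false = ih
... | true  | true  | false = cong suc ih
... | true  | true  | true  = trans (+-suc _ _) (cong suc ih)
... | true  | false | true  with () ← q⊆p here

-- Were the two elements distinct, `⁅ x ⁆` would be a proper subset of `p`, forcing 1 < 1.
∣p∣≡1⇒unique : ∣ p ∣ ≡ 1 → x ∈ p → y ∈ p → x ≡ y
∣p∣≡1⇒unique {p = p} {x = x} {y = y} ∣p∣≡1 x∈p y∈p =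
  decidable-stable (x ≟ y) λ x≢y →
    <-irrefl (trans (∣⁅x⁆∣≡1 x) (sym ∣p∣≡1))
      (p⊂q⇒∣p∣<∣q∣ ( (λ z∈⁅x⁆ → subst (_∈ p) (sym (x∈⁅y⁆⇒x≡y x z∈⁅x⁆)) x∈p)
                   , y , y∈p , λ y∈⁅x⁆ → x≢y (sym (x∈⁅y⁆⇒x≡y x y∈⁅x⁆))))

∣p∣≡1⇒nonempty : ∣ p ∣ ≡ 1 → ∃ (_∈ p)
∣p∣≡1⇒nonempty {p = true  ∷ p} _ = zero , here
∣p∣≡1⇒nonempty {p = false ∷ p} ∣p∣≡1 with ∣p∣≡1⇒nonempty {p = p} ∣p∣≡1
... | x , x∈p = suc x , there x∈p

x∈⋃⁻ : (H : Fin k → Subset n) → x ∈ ⋃ (tabulate H) → ∃[ i ] x ∈ H i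
x∈⋃⁻ {k = 0}     H x∈⊥ = contradiction x∈⊥ ∉⊥
x∈⋃⁻ {k = suc k} H x∈⋃ with x∈p∪q⁻ (H zero) _ x∈⋃
... | inj₁ x∈H₀ = zero , x∈H₀
... | inj₂ x∈⋃′ with x∈⋃⁻ (H ∘ suc) x∈⋃′
...   | i , x∈Hᵢ = suc i , x∈Hᵢ

x∈⋃⁺ : (H : Fin k → Subset n) (i : Fin k) → x ∈ H i → x ∈ ⋃ (tabulate H)
x∈⋃⁺ H zero    x∈H₀ = p⊆p∪q _ x∈H₀
x∈⋃⁺ H (suc i) x∈Hᵢ = q⊆p∪q (H zero) _ (x∈⋃⁺ (H ∘ suc) i x∈Hᵢ)

module _ (G : Graph) where
  open Graph G

  Incident⇒∈∂ : ∀ {v e} → Incident v e → e ∈ ∂ v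
  Incident⇒∈∂ {v} {e} inc =
    lookup⇒[]= e (∂ v) (trans (lookup∘tabulate _ e) (dec-true (incident? v e) inc))

  Joins⇒∈∂ : ∀ {e u w} → Joins e u w → e ∈ ∂ u × e ∈ ∂ w
  Joins⇒∈∂ (inj₁ (e₁≡u , e₂≡w)) = Incident⇒∈∂ (inj₁ e₁≡u) , Incident⇒∈∂ (inj₂ e₂≡w)
  Joins⇒∈∂ (inj₂ (e₁≡w , e₂≡u)) = Incident⇒∈∂ (inj₂ e₂≡u) , Incident⇒∈∂ (inj₁ e₁≡w)

  Connected-mono : ∀ {A B} → A ⊆ B → Connected A → Connected B
  Connected-mono A⊆B conn u w =
    Star.map (λ { (e , e∈A , joins) → e , A⊆B e∈A , joins }) (conn u w)

  -- The sum `m + k` avoids truncated subtraction; for numerals it matches the known degree by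
  -- computation.
  degreeIn-─ : ∀ {A B m k} v → A ⊆ B → degreeIn B v ≡ m + k → degreeIn A v ≡ k →
    degreeIn (B ─ A) v ≡ m
  degreeIn-─ {A} {B} {m} {k} v A⊆B degB degA = +-cancelʳ-≡ k _ _
    (trans (cong (degreeIn (B ─ A) v +_) (sym degA))
      (trans (∣d∩[p─q]∣+∣d∩q∣≡∣d∩p∣ (∂ v) B A A⊆B) degB))

  degreeIn-⊤ : ∀ v → degreeIn ⊤ v ≡ degree v
  degreeIn-⊤ v = cong ∣_∣ (∩-identityʳ (∂ v))

  matching-edge : ∀ {P} → IsPerfectMatching G P → ∀ v → ∃[ e ] (e ∈ ∂ v × e ∈ P)
  matching-edge {P} pm v with ∣p∣≡1⇒nonempty (pm v)
  ... | e , e∈ = e , x∈p∩q⁻ (∂ v) P e∈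

  matching-unique : ∀ {P} → IsPerfectMatching G P → ∀ {v e f} →
    e ∈ ∂ v → e ∈ P → f ∈ ∂ v → f ∈ P → e ≡ f
  matching-unique pm {v} e∈∂ e∈P f∈∂ f∈P =
    ∣p∣≡1⇒unique (pm v) (x∈p∩q⁺ (e∈∂ , e∈P)) (x∈p∩q⁺ (f∈∂ , f∈P))

  twoFactor-─-matching : ∀ {F M} → IsTwoFactor G F → IsPerfectMatching G M → M ⊆ F →
    IsPerfectMatching G (F ─ M)
  twoFactor-─-matching tf pm M⊆F v = degreeIn-─ v M⊆F (tf v) (pm v)

  -- For perfect matchings this means agreement at `v`, the invariant carried along the cycle `H`.
  Share : EdgeSet → EdgeSet → Vertex → Set
  Share P Q v = ∃[ e ] (e ∈ ∂ v × e ∈ P × e ∈ Q)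

  module _ {H P Q} (ham : IsHamiltonianCycle G H)
           (pmP : IsPerfectMatching G P) (pmQ : IsPerfectMatching G Q)
           (P⊆H : P ⊆ H) (Q⊆H : Q ⊆ H) where

    share-step : ∀ {u w} → Adjacent H u w → Share P Q u → Share P Q w
    share-step {u} {w} (e , e∈H , joins) (f , f∈∂u , f∈P , f∈Q)
      with Joins⇒∈∂ joins | e ∈? P
    ... | e∈∂u , e∈∂w | yes e∈P =
      e , e∈∂w , e∈P , subst (_∈ Q) (matching-unique pmP f∈∂u f∈P e∈∂u e∈P) f∈Q
    ... | e∈∂u , e∈∂w | no e∉P with matching-edge pmP w
    -- Here `e` lies in neither matching. If the `P`-edge `g` at `w` avoided `Q`, then `g` and `e`
    -- would both be edges at `w` of the matching `H ─ Q`, so `e` would equal `g` and lie in `P`.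
    ...   | g , g∈∂w , g∈P = g , g∈∂w , g∈P , decidable-stable (g ∈? Q) λ g∉Q →
      e∉P (subst (_∈ P)
        (matching-unique (twoFactor-─-matching (proj₁ ham) pmQ Q⊆H)
          g∈∂w (x∈p∧x∉q⇒x∈p─q (P⊆H g∈P) g∉Q)
          e∈∂w (x∈p∧x∉q⇒x∈p─q e∈H e∉Q))
        g∈P)
      where
      e∉Q : e ∉ Q
      e∉Q e∈Q = e∉P (subst (_∈ P) (matching-unique pmQ f∈∂u f∈Q e∈∂u e∈Q) f∈P)

    share-star : ∀ {u w} → Star (Adjacent H) u w → Share P Q u → Share P Q w
    share-star ε            = id
    share-star (adj ◅ adjs) = share-star adjs ∘ share-step adj

    -- Since `H` is connected and spanning, agreement reaches an end of every edge of `P`.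
    share⇒⊆ : ∀ {v} → Share P Q v → P ⊆ Q
    share⇒⊆ {v} sh {x} x∈P with share-star (proj₂ ham v (end₁ x)) sh
    ... | e , e∈∂ , e∈P , e∈Q =
      subst (_∈ Q) (matching-unique pmP e∈∂ e∈P (Incident⇒∈∂ (inj₁ refl)) x∈P) e∈Q

  module _ (cubic : IsCubic G) where

    degreeIn-∁ : ∀ {A m k} v → 3 ≡ m + k → degreeIn A v ≡ k → degreeIn (⊤ ─ A) v ≡ m
    degreeIn-∁ v 3≡m+k = degreeIn-─ v ⊆⊤ (trans (degreeIn-⊤ v) (trans (cubic v) 3≡m+k))

    twoFactor-∁ : ∀ {F} → IsTwoFactor G F → IsPerfectMatching G (⊤ ─ F)
    twoFactor-∁ tf v = degreeIn-∁ v refl (tf v)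

    matching-∁ : ∀ {M} → IsPerfectMatching G M → IsTwoFactor G (⊤ ─ M)
    matching-∁ pm v = degreeIn-∁ v refl (pm v)

    -- The inclusion of `K` in `F` suffices: adding edges to a connected spanning subgraph keeps it
    -- connected.
    malleable⇒twoFactor-connected : ∀ {v} → IsMalleable G 3 v →
      ∀ F → IsTwoFactor G F → Connected F
    malleable⇒twoFactor-connected {v} (_ , _ , _ , extend) F tf
      with extend (⊤ ─ F) (twoFactor-∁ tf)
    ... | Hs , Hs-ext , _ with Hs-ext zero
    ... | hamH , M⊆H
      with matching-edge (twoFactor-─-matching (proj₁ hamH) (twoFactor-∁ tf) M⊆H) v
         | extend (⊤ ─ Hs zero) (twoFactor-∁ (proj₁ hamH))
    ... | f , f∈∂v , f∈Q | Ks , Ks-ext , cover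
      -- As `f` lies in `H`, it avoids N = `⊤ ─ H`, so one of the cycles extending N contains it.
      with x∈⋃⁻ Ks (cover (x∈p∧x∉q⇒x∈p─q f∈∂v
             (λ f∈∁H → x∈p─q⇒x∉q {p = ⊤} f∈∁H (p─q⊆p (Hs zero) _ f∈Q))))
    ... | i , f∈K with Ks-ext i
    ... | hamK , N⊆K = Connected-mono K⊆F (proj₂ hamK)
      where
      H K : EdgeSet
      H = Hs zero
      K = Ks i

      ∉∁⇒∈ : ∀ {A : EdgeSet} {x} → x ∉ ⊤ ─ A → x ∈ A
      ∉∁⇒∈ {A} {x} x∉∁A = decidable-stable (x ∈? A) (x∉∁A ∘ x∈p∧x∉q⇒x∈p─q ∈⊤)

      ∈H⇒∉∁H : ∀ {x} → x ∈ H → x ∉ ⊤ ─ H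
      ∈H⇒∉∁H x∈H x∈∁H = x∈p─q⇒x∉q {p = ⊤} x∈∁H x∈H

      K─∁H⊆H : K ─ (⊤ ─ H) ⊆ H
      K─∁H⊆H x∈ = ∉∁⇒∈ (x∈p─q⇒x∉q {p = K} x∈)

      K─∁H⊆H─∁F : K ─ (⊤ ─ H) ⊆ H ─ (⊤ ─ F)
      -- Both sides are perfect matchings inside the cycle `H`, and they agree at `v` through `f`.
      K─∁H⊆H─∁F = share⇒⊆ hamH
        (twoFactor-─-matching (proj₁ hamK) (twoFactor-∁ (proj₁ hamH)) N⊆K)
        (twoFactor-─-matching (proj₁ hamH) (twoFactor-∁ tf) M⊆H)
        K─∁H⊆H
        (p─q⊆p H _)
        (f , f∈∂v , x∈p∧x∉q⇒x∈p─q f∈K (∈H⇒∉∁H (p─q⊆p H _ f∈Q)) , f∈Q)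

      K⊆F : K ⊆ F
      -- Either way `x` avoids M = `⊤ ─ F`: inside `H` by the inclusion just shown, outside `H`
      -- because M is contained in `H`.
      K⊆F {x} x∈K with x ∈? H
      ... | yes x∈H = ∉∁⇒∈ (x∈p─q⇒x∉q {p = H}
                        (K─∁H⊆H─∁F (x∈p∧x∉q⇒x∈p─q x∈K (∈H⇒∉∁H x∈H))))
      ... | no  x∉H = ∉∁⇒∈ (x∉H ∘ M⊆H)

    twoFactors-connected⇒malleable : (∀ F → IsTwoFactor G F → Connected F) →
      ∃ (IsPerfectMatching G) →
      (∀ M → IsPerfectMatching G M → ∃[ H ] (IsHamiltonianCycle G H × M ⊆ H)) →
      ∀ v → IsMalleable G 3 v
    twoFactors-connected⇒malleable conn pm∃ extend v =
      s≤s (s≤s z≤n) , cubic v , pm∃ , cycles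
      where
      cycles : ∀ M → IsPerfectMatching G M →
        ∃ λ (C : Fin 2 → EdgeSet) →
          (∀ i → IsHamiltonianCycle G (C i) × M ⊆ C i) × (∂ v ─ M) ⊆ ⋃ (tabulate C)
      cycles M pm with extend M pm
      ... | H , ham , M⊆H = C , C-ext , λ {x} _ → cover x
        where
        C : Fin 2 → EdgeSet
        C zero       = H
        -- This is M ∪ N, written as the complement of the perfect matching `H ─ M` so that it is a
        -- 2-factor by `matching-∁`.
        C (suc zero) = ⊤ ─ (H ─ M)

        tf : IsTwoFactor G (⊤ ─ (H ─ M))
        tf = matching-∁ (twoFactor-─-matching (proj₁ ham) pm M⊆H)

        C-ext : ∀ i → IsHamiltonianCycle G (C i) × M ⊆ C i
        C-ext zero       = ham , M⊆H
        C-ext (suc zero) = (tf , conn _ tf) , λ x∈M →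
          x∈p∧x∉q⇒x∈p─q ∈⊤ (λ x∈H─M → x∈p─q⇒x∉q {p = H} x∈H─M x∈M)

        -- Removing only edges of `H` from `⊤` leaves every edge outside `H` in the second cycle.
        cover : ∀ x → x ∈ ⋃ (tabulate C)
        cover x with x ∈? H
        ... | yes x∈H = x∈⋃⁺ C zero x∈H
        ... | no  x∉H = x∈⋃⁺ C (suc zero) (x∈p∧x∉q⇒x∈p─q ∈⊤ (x∉H ∘ p─q⊆p H M))

proposition2p3 : (G : Graph) → IsCubic G → ∃ (IsMalleable G 3) →
    Is2FH G × (∀ v → IsMalleable G 3 v)
proposition2p3 G cubic (_ , mall@(_ , _ , (M , pm) , extend)) =
  ( (proj₁ (extendOne M pm) , proj₁ (proj₂ (extendOne M pm)))
  , λ F tf → tf , conn F tf)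
  , twoFactors-connected⇒malleable G cubic conn (M , pm) extendOne
  where
  conn : ∀ F → IsTwoFactor G F → Graph.Connected G F
  conn = malleable⇒twoFactor-connected G cubic mall

  extendOne : ∀ M → IsPerfectMatching G M → ∃[ H ] (IsHamiltonianCycle G H × M ⊆ H)
  extendOne M pm with extend M pm
  ... | Hs , Hs-ext , _ = Hs zero , Hs-ext zero
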